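{- Let $\mathbb{F}_q$ be a finite field with $q=p^r$ elements. For every integer $\ell$ with $\frac{q}{2}\le \ell<q-3$ there exists a multiset $M$ of $q$ elements of $\mathbb{F}_q$ with $\sum_{b\in M}b=0$, in which $0$ has multiplicity $\ell$ and $\ell$ is the highest multiplicity of any element of $M$, such that every polynomial $f\in\mathbb{F}_q[x]$ with range $M$ has degree greater than $\ell$.
   Context: The range of a polynomial $f\in\mathbb{F}_q[x]$ is the multiset $\{f(x): x\in\mathbb{F}_q\}$ of size $q$ (values counted with multiplicity). A polynomial has prescribed range $M$ if its range equals $M$ as a multiset. -}

module Defs where

open import Level using (Level; _⊔_)
open import Algebra.Bundles using (CommutativeRing)
open import Data.Nat using (ℕ; zero; suc; _<_; _≤_)
open import Data.Fin using (Fin)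
open import Data.List using (List; []; _∷_)
open import Data.Maybe using (Maybe; just; nothing)
open import Data.Product using (∃)
open import Relation.Nullary using (¬_; Dec; yes; no)
open import Relation.Binary.PropositionalEquality using (_≡_)

record FiniteField (c ℓ : Level) (q : ℕ) : Set (Level.suc (c ⊔ ℓ)) where
  field
    commRing : CommutativeRing c ℓ
  open CommutativeRing commRing public
  field
    0≉1      : ¬ (0# ≈ 1#)
    inverse  : ∀ x → ¬ (x ≈ 0#) → ∃ λ y → (x * y) ≈ 1#
    _≟_      : ∀ x y → Dec (x ≈ y)
    elem     : Fin q → Carrier
    elem-inj : ∀ i j → elem i ≈ elem j → i ≡ j
    elem-sur : ∀ x → ∃ λ i → elem i ≈ x

module FieldDefs {c ℓ : Level} {q : ℕ} (F : FiniteField c ℓ q) where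
  open FiniteField F

  -- A multiset of n elements of F_q, given as an n-tuple (order irrelevant:
  -- only multiplicities and the sum are ever used).
  Tuple : ℕ → Set c
  Tuple n = Fin n → Carrier

  mult : ∀ {n} → Tuple n → Carrier → ℕ
  mult {zero}  v b = 0
  mult {suc n} v b with v Fin.zero ≟ b
  ... | yes _ = suc (mult (λ i → v (Fin.suc i)) b)
  ... | no  _ = mult (λ i → v (Fin.suc i)) b

  sumT : ∀ {n} → Tuple n → Carrier
  sumT {zero}  v = 0#
  sumT {suc n} v = v Fin.zero + sumT (λ i → v (Fin.suc i))

  _≋_ : ∀ {n} → Tuple n → Tuple n → Set c
  u ≋ v = ∀ b → mult u b ≡ mult v b

  -- polynomials in F_q[x]: coefficient lists, constant term first
  Poly : Set c
  Poly = List Carrier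

  eval : Poly → Carrier → Carrier
  eval []       x = 0#
  eval (a ∷ as) x = a + x * eval as x

  -- degree; nothing for the zero polynomial (degree -∞)
  degree : Poly → Maybe ℕ
  degree []       = nothing
  degree (a ∷ as) with degree as
  ... | just d  = just (suc d)
  ... | nothing with a ≟ 0#
  ...   | yes _ = nothing
  ...   | no  _ = just 0

  range : Poly → Tuple q
  range f i = eval f (elem i)

  HasRange : Poly → Tuple q → Set c
  HasRange f M = range f ≋ M

{-# OPTIONS --safe #-}

-- Put m = q − ℓ ≥ 4 and let M consist of ℓ zeros and of nonzero a₁, …, a_m with sum 0.
-- A polynomial of degree at most ℓ with range M has ℓ distinct roots, so it is c ∏ (x − t)
-- over the complement of {s₁, …, s_m}, where sᵢ is the point with value aᵢ.  An affine
-- substitution gives s₁ = 0 and s₂ = 1; if moreover a₁ = 1, then c is determined, and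
-- (a₃, …, a_m) is a function of (s₃, …, s_m).  This tuple avoids 0 and 1, so there are at
-- most (q − 2)^(m − 2) attained tuples (a₃, …, a_m).  But at least (q − 1)^(m − 3) (q − 2)
-- tuples of nonzero elements have 1 + a₃ + … + a_m ≠ 0, that is, leave a nonzero a₂, and
-- this is more since m > 3.
module Submission where

open import Defs
open import Level using (Level) renaming (_⊔_ to _⊔ˡ_)
open import Data.Nat using (ℕ; zero; suc; z≤n; s≤s; _<_; _≤_; _∸_)
import Data.Nat as ℕ
import Data.Nat.Properties as ℕ
open import Data.Fin using (Fin; zero; suc; punchIn; punchOut; splitAt; _↑ˡ_; _↑ʳ_)
import Data.Fin.Properties as Fin
open import Data.Maybe using (just; nothing)
open import Data.Product using (∃; _×_; Σ; _,_; proj₁; proj₂)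
open import Data.Sum using (inj₁; inj₂)
open import Data.List using (List; []; _∷_; length; filter; foldr; allFin; cartesianProductWith; concatMap)
import Data.List as List
import Data.List.Properties as List
open import Data.List.Membership.Propositional using (_∈_; _∉_)
open import Data.List.Membership.Propositional.Properties using (∈-filter⁺; ∈-filter⁻; ∈-allFin; ∈-map⁺; ∈-map⁻; ∈-++⁻; ∈-cartesianProductWith⁺)
open import Data.List.Relation.Unary.Any using (here; there)
import Data.List.Relation.Unary.Any as Any
open import Data.List.Relation.Unary.All using ([]; _∷_)
import Data.List.Relation.Unary.All as All
open import Data.List.Relation.Unary.AllPairs using ([]; _∷_)
open import Data.List.Relation.Unary.Unique.Propositional using (Unique)
import Data.List.Relation.Unary.Unique.Propositional.Properties as Unique
open import Data.Vec using (Vec; []; _∷_; lookup; tabulate; toList; replicate; _++_)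
import Data.Vec as Vec
import Data.Vec.Properties as Vec
open import Data.Vec.Membership.Propositional.Properties using (∈-toList⁺; ∈-tabulate⁺)
open import Data.Vec.Relation.Unary.All using ([]; _∷_) renaming (All to Allᵛ)
import Data.Vec.Relation.Unary.All as Allᵛ
import Data.Vec.Relation.Unary.All.Properties as Allᵛ
open import Function using (_∘_)
open import Function.Definitions using (Injective)
open import Relation.Nullary using (¬_; yes; no; contradiction; ¬?)
open import Relation.Binary.Definitions using (DecidableEquality)
open import Relation.Binary.PropositionalEquality using (_≡_; _≢_; refl; sym; trans; cong; cong₂; subst)
import Algebra.Properties.Group as GroupProperties
import Algebra.Solver.Ring.NaturalCoefficients.Default as SemiringSolver
import Relation.Binary.Reasoning.Setoid as SetoidReasoning

-- Differences of duplicate-free lists and the pigeonhole principle.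

module ListDifference {a} {A : Set a} (_≟_ : DecidableEquality A) where

  infixl 5 _∖_

  _∖_ : List A → List A → List A
  xs ∖ []       = xs
  xs ∖ (y ∷ ys) = filter (λ z → ¬? (z ≟ y)) (xs ∖ ys)

  ∈-∖⁺ : ∀ {x xs} ys → x ∈ xs → x ∉ ys → x ∈ xs ∖ ys
  ∈-∖⁺ []       x∈xs _    = x∈xs
  ∈-∖⁺ (y ∷ ys) x∈xs x∉ys =
    ∈-filter⁺ (λ z → ¬? (z ≟ y)) (∈-∖⁺ ys x∈xs (x∉ys ∘ there)) (x∉ys ∘ here)

  ∈-∖⁻ : ∀ {x xs} ys → x ∈ xs ∖ ys → x ∈ xs × x ∉ ys
  ∈-∖⁻ []       x∈ = x∈ , λ ()
  ∈-∖⁻ (y ∷ ys) x∈ with ∈-filter⁻ (λ z → ¬? (z ≟ y)) x∈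
  ... | x∈∖ , x≢y with ∈-∖⁻ ys x∈∖
  ...   | x∈xs , x∉ys = x∈xs , λ { (here x≡y) → x≢y x≡y ; (there x∈ys) → x∉ys x∈ys }

  ∖-unique : ∀ {xs} ys → Unique xs → Unique (xs ∖ ys)
  ∖-unique []       u = u
  ∖-unique (y ∷ ys) u = Unique.filter⁺ (λ z → ¬? (z ≟ y)) (∖-unique ys u)

  -- By uniqueness `y` occurs at most once: when it is met at the head, the filter keeps the whole
  -- tail.
  length-remove : ∀ {xs} y → Unique xs → length xs ≤ suc (length (filter (λ z → ¬? (z ≟ y)) xs))
  length-remove y [] = z≤n
  length-remove {x ∷ xs} y (x∉xs ∷ u) with x ≟ y
  ... | yes refl = s≤s (ℕ.≤-reflexive (sym (cong length (List.filter-all (λ z → ¬? (z ≟ y))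
                     (All.map (λ x≢z z≡x → x≢z (sym z≡x)) x∉xs)))))
  ... | no  _    = s≤s (length-remove y u)

  length-∖ : ∀ {xs} ys → Unique xs → length xs ≤ length ys ℕ.+ length (xs ∖ ys)
  length-∖ []       u = ℕ.≤-refl
  length-∖ (y ∷ ys) u = ℕ.≤-trans (length-∖ ys u) (ℕ.≤-trans
    (ℕ.+-monoʳ-≤ (length ys) (length-remove y (∖-unique ys u)))
    (ℕ.≤-reflexive (ℕ.+-suc (length ys) _)))

  length-∖-∷ : ∀ {y xs} ys → y ∈ xs → y ∉ ys → length (xs ∖ (y ∷ ys)) < length (xs ∖ ys)
  length-∖-∷ {y} {xs} ys y∈xs y∉ys = List.filter-notAll (λ z → ¬? (z ≟ y)) (xs ∖ ys)
    (Any.map (λ y≡z z≢y → z≢y (sym y≡z)) (∈-∖⁺ ys y∈xs y∉ys))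

  -- Pigeonhole: an empty difference would contradict `length-∖`. Since `ys` may have repetitions,
  -- it can be the list of all values of a function that is not injective.
  missing : ∀ {xs ys} → Unique xs → length ys < length xs → ∃ λ x → x ∈ xs × x ∉ ys
  missing {xs} {ys} u ys<xs with xs ∖ ys in eq
  ... | [] = contradiction ys<xs (ℕ.≤⇒≯ (ℕ.≤-trans (length-∖ ys u)
               (ℕ.≤-reflexive (trans (cong (λ zs → length ys ℕ.+ length zs) eq) (ℕ.+-identityʳ _)))))
  ... | x ∷ _ = x , ∈-∖⁻ ys (subst (x ∈_) (sym eq) (here refl))

-- Listing and counting words.

module _ {a} {A : Set a} where

  words : List A → ∀ n → List (Vec A n)
  words xs zero    = [] ∷ []
  words xs (suc n) = cartesianProductWith _∷_ xs (words xs n)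

  ∈-words : ∀ {xs n} {v : Vec A n} → Allᵛ (_∈ xs) v → v ∈ words xs n
  ∈-words []       = here refl
  ∈-words (p ∷ ps) = ∈-cartesianProductWith⁺ _∷_ p (∈-words ps)

  length-words : ∀ xs n → length (words xs n) ≡ length xs ℕ.^ n
  length-words xs zero    = refl
  length-words xs (suc n) = trans (length-cartesianProductWith _∷_ xs (words xs n))
                                  (cong (length xs ℕ.*_) (length-words xs n))
    where
    length-cartesianProductWith : ∀ {b c} {B : Set b} {C : Set c} (f : A → B → C) xs ys →
                                  length (cartesianProductWith f xs ys) ≡ length xs ℕ.* length ys
    length-cartesianProductWith f []       ys = refl
    length-cartesianProductWith f (x ∷ xs) ys = trans (List.length-++ (List.map (f x) ys))
      (cong₂ ℕ._+_ (List.length-map (f x) ys) (length-cartesianProductWith f xs ys))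

  module _ {n} (g : A → List (Vec A n)) where

    -- A dependent variant of `words`: the tails allowed may vary with the head, as they must when
    -- the entries are tied by a condition on their sum.
    prefixed : List A → List (Vec A (suc n))
    prefixed = concatMap (λ x → List.map (x ∷_) (g x))

    ∈-prefixed⁻ : ∀ xs {v} → v ∈ prefixed xs → ∃ λ x → ∃ λ w → x ∈ xs × w ∈ g x × v ≡ x ∷ w
    ∈-prefixed⁻ (x ∷ xs) v∈ with ∈-++⁻ (List.map (x ∷_) (g x)) v∈
    ... | inj₁ v∈ˡ with ∈-map⁻ (x ∷_) v∈ˡ
    ...   | w , w∈ , eq = x , w , here refl , w∈ , eq
    ∈-prefixed⁻ (x ∷ xs) v∈ | inj₂ v∈ʳ with ∈-prefixed⁻ xs v∈ʳ
    ...   | y , w , y∈ , w∈ , eq = y , w , there y∈ , w∈ , eq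

    prefixed-unique : ∀ {xs} → Unique xs → (∀ x → Unique (g x)) → Unique (prefixed xs)
    prefixed-unique [] ug = []
    prefixed-unique {x ∷ xs} (x∉xs ∷ u) ug =
      Unique.++⁺ (Unique.map⁺ Vec.∷-injectiveʳ (ug x)) (prefixed-unique u ug) disjoint
      where
      disjoint : ∀ {v} → ¬ (v ∈ List.map (x ∷_) (g x) × v ∈ prefixed xs)
      disjoint (v∈ˡ , v∈ʳ) with ∈-map⁻ (x ∷_) v∈ˡ | ∈-prefixed⁻ xs v∈ʳ
      ... | _ , _ , refl | y , _ , y∈ , _ , eq = All.lookup x∉xs y∈ (Vec.∷-injectiveˡ eq)

    length-prefixed : ∀ {b} xs → (∀ x → b ≤ length (g x)) → length xs ℕ.* b ≤ length (prefixed xs)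
    length-prefixed []       b≤ = z≤n
    length-prefixed (x ∷ xs) b≤ = ℕ.≤-trans
      (ℕ.+-mono-≤ (ℕ.≤-trans (b≤ x) (ℕ.≤-reflexive (sym (List.length-map (x ∷_) (g x)))))
                  (length-prefixed xs b≤))
      (ℕ.≤-reflexive (sym (List.length-++ (List.map (x ∷_) (g x)))))

-- A missed `j` could be punched out of the codomain, which would leave an injection into a set
-- smaller than `Fin m`.
injective⇒surjective : ∀ {m n} {σ : Fin m → Fin n} → n ≤ m → Injective _≡_ _≡_ σ → ∀ j → ∃ λ i → σ i ≡ j
injective⇒surjective {n = suc n} {σ} n<m inj j with Fin.any? (λ i → σ i Fin.≟ j)
... | yes hit = hit
... | no miss = contradiction
  (λ {x} {y} eq → inj (Fin.punchOut-injective (λ j≡ → miss (x , sym j≡)) (λ j≡ → miss (y , sym j≡)) eq))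
  (Fin.<⇒notInjective {f = λ i → punchOut {i = j} {σ i} (λ j≡ → miss (i , sym j≡))} n<m)

module PolynomialRanges {c ℓ' : Level} {q : ℕ} (F : FiniteField c ℓ' q) where
  open FiniteField F hiding (zero) renaming (refl to ≈-refl; sym to ≈-sym; trans to ≈-trans; reflexive to ≈-reflexive)
  open FieldDefs F
  open GroupProperties +-group using () renaming (inverseʳ-unique to +-inverseʳ-unique; ∙-cancelˡ to +-cancelˡ; x∙y⁻¹≈ε⇒x≈y to x-y≈0⇒x≈y; x≈y⇒x∙y⁻¹≈ε to x≈y⇒x-y≈0)
  open SemiringSolver commutativeSemiring using (solve; _:+_; _:*_; _:=_)
  open SetoidReasoning setoid

  -- Field arithmetic and indices of elements.

  x≈y+[x-y] : ∀ x y → x ≈ y + (x - y)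
  x≈y+[x-y] x y = begin
    x              ≈⟨ +-identityˡ x ⟨
    0# + x         ≈⟨ +-congʳ (-‿inverseʳ y) ⟨
    (y - y) + x    ≈⟨ +-assoc y (- y) x ⟩
    y + (- y + x)  ≈⟨ +-congˡ (+-comm (- y) x) ⟩
    y + (x - y)    ∎

  x*y≈0⇒y≈0 : ∀ {x y} → ¬ (x ≈ 0#) → x * y ≈ 0# → y ≈ 0#
  x*y≈0⇒y≈0 {x} {y} x≉0 xy≈0 with inverse x x≉0
  ... | z , xz≈1 = begin
    y            ≈⟨ *-identityˡ y ⟨
    1# * y       ≈⟨ *-congʳ xz≈1 ⟨
    x * z * y    ≈⟨ solve 3 (λ x z y → x :* z :* y := z :* (x :* y)) ≈-refl x z y ⟩
    z * (x * y)  ≈⟨ *-congˡ xy≈0 ⟩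
    z * 0#       ≈⟨ zeroʳ z ⟩
    0#           ∎

  -- The value at 0# is junk.
  inv : Carrier → Carrier
  inv x with x ≟ 0#
  ... | yes _  = 0#
  ... | no x≉0 = proj₁ (inverse x x≉0)

  -- Serves to turn the constant of a factorisation, known only through one value of the polynomial,
  -- into an explicit function of the roots.
  x*y≈1⇒y≈inv : ∀ {x y} → x * y ≈ 1# → y ≈ inv x
  x*y≈1⇒y≈inv {x} {y} xy≈1 with x ≟ 0#
  ... | yes x≈0 = contradiction (≈-trans (≈-sym (≈-trans (*-congʳ x≈0) (zeroˡ y))) xy≈1) 0≉1
  ... | no x≉0 with inverse x x≉0
  ...   | z , xz≈1 = begin
    y            ≈⟨ *-identityˡ y ⟨
    1# * y       ≈⟨ *-congʳ xz≈1 ⟨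
    x * z * y    ≈⟨ solve 3 (λ x z y → x :* z :* y := x :* y :* z) ≈-refl x z y ⟩
    x * y * z    ≈⟨ *-congʳ xy≈1 ⟩
    1# * z       ≈⟨ *-identityˡ z ⟩
    z            ∎

  -- Elements are handled through indices, where `≡` is decidable and agrees with `≈` of the
  -- elements; lists and vectors of them can then be counted.
  index : Carrier → Fin q
  index x = proj₁ (elem-sur x)

  elem-index : ∀ x → elem (index x) ≈ x
  elem-index x = proj₂ (elem-sur x)

  index-unique : ∀ {i x} → elem i ≈ x → i ≡ index x
  index-unique {i} {x} eq = elem-inj i (index x) (≈-trans eq (≈-sym (elem-index x)))

  -- Degree bounds for functions.

  -- Divided differences make the degree bound stable under affine substitutions
  -- without having to compute with coefficients.
  Degree≤ : ℕ → (Carrier → Carrier) → Set (c ⊔ˡ ℓ')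
  Degree≤ zero    f = ∀ x y → f x ≈ f y
  Degree≤ (suc n) f = ∀ t → ∃ λ g → Degree≤ n g × (∀ x → f x ≈ f t + (x - t) * g x)

  -- A function on `Carrier` need not respect `≈`. Under a degree bound it does, because f(x) and
  -- f(y) differ by a multiple of x - y.
  Degree≤-cong : ∀ n {f} → Degree≤ n f → ∀ {x y} → x ≈ y → f x ≈ f y
  Degree≤-cong zero    f≤ _ = f≤ _ _
  Degree≤-cong (suc n) {f} f≤ {x} {y} x≈y with f≤ y
  ... | g , _ , eq = begin
    f x                  ≈⟨ eq x ⟩
    f y + (x - y) * g x  ≈⟨ +-congˡ (*-congʳ (x≈y⇒x-y≈0 x≈y)) ⟩
    f y + 0# * g x       ≈⟨ +-congˡ (zeroˡ (g x)) ⟩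
    f y + 0#             ≈⟨ +-identityʳ (f y) ⟩
    f y                  ∎

  Degree≤-const : ∀ n {f} → (∀ x y → f x ≈ f y) → Degree≤ n f
  Degree≤-const zero    eq = eq
  Degree≤-const (suc n) {f} eq t = (λ _ → 0#) , Degree≤-const n (λ _ _ → ≈-refl) , λ x → begin
    f x                 ≈⟨ eq x t ⟩
    f t                 ≈⟨ +-identityʳ (f t) ⟨
    f t + 0#            ≈⟨ +-congˡ (zeroʳ (x - t)) ⟨
    f t + (x - t) * 0#  ∎

  Degree≤-suc : ∀ n {f} → Degree≤ n f → Degree≤ (suc n) f
  Degree≤-suc zero    f≤ = Degree≤-const 1 f≤
  Degree≤-suc (suc n) f≤ t with f≤ t
  ... | g , g≤ , eq = g , Degree≤-suc n g≤ , eq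

  Degree≤-mono : ∀ {m n f} → m ≤ n → Degree≤ m f → Degree≤ n f
  Degree≤-mono {n = n} z≤n f≤ = Degree≤-const n f≤
  Degree≤-mono (s≤s m≤n) f≤ t with f≤ t
  ... | g , g≤ , eq = g , Degree≤-mono m≤n g≤ , eq

  -- This combination is the shape of the quotients in `Degree≤-horner` and, with zero for `f`, in
  -- `Degree≤-affine`.
  Degree≤-+* : ∀ n {f g} a → Degree≤ n f → Degree≤ n g → Degree≤ n (λ x → f x + a * g x)
  Degree≤-+* zero    a f≤ g≤ x y = +-cong (f≤ x y) (*-congˡ (g≤ x y))
  Degree≤-+* (suc n) {f} {g} a f≤ g≤ t with f≤ t | g≤ t
  ... | f' , f'≤ , f-eq | g' , g'≤ , g-eq =
    (λ x → f' x + a * g' x) , Degree≤-+* n a f'≤ g'≤ , λ x → begin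
    f x + a * g x
      ≈⟨ +-cong (f-eq x) (*-congˡ (g-eq x)) ⟩
    f t + (x - t) * f' x + a * (g t + (x - t) * g' x)
      ≈⟨ solve 6 (λ u v w y z a → u :+ v :* w :+ a :* (y :+ v :* z) := u :+ a :* y :+ v :* (w :+ a :* z))
               ≈-refl (f t) (x - t) (f' x) (g t) (g' x) a ⟩
    f t + a * g t + (x - t) * (f' x + a * g' x) ∎

  -- From x f(x) - t f(t) = (x - t) f(x) + t (f(x) - f(t)) the divided difference at t is f + t g,
  -- where g is that of f; for constant f it is f itself.
  Degree≤-horner : ∀ n {f} a → Degree≤ n f → Degree≤ (suc n) (λ x → a + x * f x)
  Degree≤-horner zero    {f} a f≤ t = f , f≤ , λ x → begin
    a + x * f x                  ≈⟨ +-congˡ (*-congʳ (x≈y+[x-y] x t)) ⟩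
    a + (t + (x - t)) * f x      ≈⟨ solve 4 (λ a t d u → a :+ (t :+ d) :* u := a :+ t :* u :+ d :* u) ≈-refl a t (x - t) (f x) ⟩
    a + t * f x + (x - t) * f x  ≈⟨ +-congʳ (+-congˡ (*-congˡ (f≤ x t))) ⟩
    a + t * f t + (x - t) * f x  ∎
  Degree≤-horner (suc n) {f} a f≤ t with f≤ t
  ... | g , g≤ , eq = (λ x → f x + t * g x) , Degree≤-+* (suc n) t f≤ (Degree≤-suc n g≤) , λ x → begin
    a + x * f x
      ≈⟨ +-congˡ (*-congʳ (x≈y+[x-y] x t)) ⟩
    a + (t + (x - t)) * f x
      ≈⟨ solve 4 (λ a t d u → a :+ (t :+ d) :* u := a :+ t :* u :+ d :* u) ≈-refl a t (x - t) (f x) ⟩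
    a + t * f x + (x - t) * f x
      ≈⟨ +-congʳ (+-congˡ (*-congˡ (eq x))) ⟩
    a + t * (f t + (x - t) * g x) + (x - t) * f x
      ≈⟨ solve 6 (λ a t d u v w → a :+ t :* (w :+ d :* v) :+ d :* u := a :+ t :* w :+ d :* (u :+ t :* v))
               ≈-refl a t (x - t) (f x) (g x) (f t) ⟩
    a + t * f t + (x - t) * (f x + t * g x) ∎

  Degree≤-affine : ∀ n {f} a b → Degree≤ n f → Degree≤ n (λ x → f (b + a * x))
  Degree≤-affine zero    a b f≤ x y = f≤ _ _
  Degree≤-affine (suc n) {f} a b f≤ t with f≤ (b + a * t)
  ... | g , g≤ , eq =
    -- By the chain rule for divided differences the quotient is `a` times that of `f`; the summand
    -- `0#` only fits it to `Degree≤-+*`.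
    (λ x → 0# + a * g (b + a * x)) ,
    Degree≤-+* n a (Degree≤-const n (λ _ _ → ≈-refl)) (Degree≤-affine n a b g≤) , λ x → begin
    f (b + a * x)
      ≈⟨ eq (b + a * x) ⟩
    f (b + a * t) + (b + a * x - (b + a * t)) * g (b + a * x)
      ≈⟨ +-congˡ (*-congʳ (difference x)) ⟩
    f (b + a * t) + (x - t) * a * g (b + a * x)
      ≈⟨ +-congˡ (≈-trans (*-assoc _ _ _) (*-congˡ (≈-sym (+-identityˡ _)))) ⟩
    f (b + a * t) + (x - t) * (0# + a * g (b + a * x)) ∎
    where
    difference : ∀ x → b + a * x - (b + a * t) ≈ (x - t) * a
    difference x = begin
      b + a * x - (b + a * t)
        ≈⟨ +-congʳ (+-congˡ (*-congˡ (x≈y+[x-y] x t))) ⟩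
      b + a * (t + (x - t)) - (b + a * t)
        ≈⟨ solve 5 (λ a b t d m → b :+ a :* (t :+ d) :+ m := d :* a :+ ((b :+ a :* t) :+ m)) ≈-refl a b t (x - t) (- (b + a * t)) ⟩
      (x - t) * a + ((b + a * t) - (b + a * t))
        ≈⟨ +-congˡ (-‿inverseʳ _) ⟩
      (x - t) * a + 0#
        ≈⟨ +-identityʳ _ ⟩
      (x - t) * a ∎

  -- From coefficient lists to degree bounds.

  degree-nothing : ∀ f → degree f ≡ nothing → ∀ x → eval f x ≈ 0#
  degree-nothing []       _ x = ≈-refl
  degree-nothing (a ∷ as) p x with degree as in eq
  degree-nothing (a ∷ as) () x | just _
  ... | nothing with a ≟ 0#
  ...   | yes a≈0 = begin
    a + x * eval as x  ≈⟨ +-cong a≈0 (*-congˡ (degree-nothing as eq x)) ⟩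
    0# + x * 0#        ≈⟨ +-identityˡ _ ⟩
    x * 0#             ≈⟨ zeroʳ x ⟩
    0#                 ∎
  degree-nothing (a ∷ as) () x | nothing | no _

  degree-just : ∀ f {d} → degree f ≡ just d → Degree≤ d (eval f)
  degree-just (a ∷ as) p with degree as in eq
  degree-just (a ∷ as) refl | just d = Degree≤-horner d a (degree-just as eq)
  degree-just (a ∷ as) p | nothing with a ≟ 0#
  degree-just (a ∷ as) () | nothing | yes _
  degree-just (a ∷ as) refl | nothing | no _ = λ x y → +-congˡ (begin
    x * eval as x  ≈⟨ *-congˡ (degree-nothing as eq x) ⟩
    x * 0#         ≈⟨ zeroʳ x ⟩
    0#             ≈⟨ zeroʳ y ⟨
    y * 0#         ≈⟨ *-congˡ (degree-nothing as eq y) ⟨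
    y * eval as y  ∎)

  -- Factorisation over distinct roots.

  vanishing : List (Fin q) → Carrier → Carrier
  vanishing T x = foldr (λ t p → (x - elem t) * p) 1# T

  -- Divide out one root at a time. The quotient at t still vanishes at every other root s because s
  -- - t is nonzero, and its degree bound drops by one until it is constant.
  factorisation : ∀ {n f} T → Degree≤ n f → Unique T → (∀ {t} → t ∈ T → f (elem t) ≈ 0#) →
                  n ≤ length T → ∃ λ c → ∀ x → f x ≈ vanishing T x * c
  factorisation {zero} {f} []      f≤ u roots n≤ = f 0# , λ x → ≈-trans (f≤ x 0#) (≈-sym (*-identityˡ _))
  -- Roots are left over: a constant with a root is zero, so the factor is `0#`.
  factorisation {zero}     (t ∷ T) f≤ u roots n≤ = 0# , λ x →
    ≈-trans (f≤ x (elem t)) (≈-trans (roots (here refl)) (≈-sym (zeroʳ _)))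
  factorisation {suc n} {f} (t ∷ T) f≤ (t∉T ∷ u) roots (s≤s n≤) with f≤ (elem t)
  ... | g , g≤ , eq = let c , g-eq = factorisation T g≤ u g-roots n≤ in c , λ x → begin
      f x                                 ≈⟨ f-eq x ⟩
      (x - elem t) * g x                  ≈⟨ *-congˡ (g-eq x) ⟩
      (x - elem t) * (vanishing T x * c)  ≈⟨ *-assoc _ _ _ ⟨
      (x - elem t) * vanishing T x * c    ∎
    where
    f-eq : ∀ x → f x ≈ (x - elem t) * g x
    f-eq x = begin
      f x                              ≈⟨ eq x ⟩
      f (elem t) + (x - elem t) * g x  ≈⟨ +-congʳ (roots (here refl)) ⟩
      0# + (x - elem t) * g x          ≈⟨ +-identityˡ _ ⟩
      (x - elem t) * g x               ∎
    g-roots : ∀ {s} → s ∈ T → g (elem s) ≈ 0#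
    g-roots {s} s∈T = x*y≈0⇒y≈0
      (λ s-t≈0 → All.lookup t∉T s∈T (sym (elem-inj s t (x-y≈0⇒x≈y _ _ s-t≈0))))
      (≈-trans (≈-sym (f-eq (elem s))) (roots (there s∈T)))

  -- Multiplicities and embeddings of tuples.

  mult-yes : ∀ {n} (u : Tuple (suc n)) {b} → u zero ≈ b → mult u b ≡ suc (mult (u ∘ suc) b)
  mult-yes u {b} eq with u zero ≟ b
  ... | yes _  = refl
  ... | no neq = contradiction eq neq

  mult-no : ∀ {n} (u : Tuple (suc n)) {b} → ¬ (u zero ≈ b) → mult u b ≡ mult (u ∘ suc) b
  mult-no u {b} neq with u zero ≟ b
  ... | yes eq = contradiction eq neq
  ... | no _   = refl

  mult-punchIn-yes : ∀ {n} (u : Tuple (suc n)) i {b} → u i ≈ b → mult u b ≡ suc (mult (u ∘ punchIn i) b)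
  mult-punchIn-yes u zero eq = mult-yes u eq
  mult-punchIn-yes {suc n} u (suc i) {b} eq with u zero ≟ b
  ... | yes _ = cong suc (mult-punchIn-yes (u ∘ suc) i eq)
  ... | no _  = mult-punchIn-yes (u ∘ suc) i eq

  mult-punchIn-no : ∀ {n} (u : Tuple (suc n)) i {b} → ¬ (u i ≈ b) → mult u b ≡ mult (u ∘ punchIn i) b
  mult-punchIn-no u zero neq = mult-no u neq
  mult-punchIn-no {suc n} u (suc i) {b} neq with u zero ≟ b
  ... | yes _ = cong suc (mult-punchIn-no (u ∘ suc) i neq)
  ... | no _  = mult-punchIn-no (u ∘ suc) i neq

  mult-positive : ∀ {n} (u : Tuple n) {b} → 0 < mult u b → ∃ λ i → u i ≈ b
  mult-positive {suc n} u {b} pos with u zero ≟ b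
  ... | yes eq = zero , eq
  ... | no _   = let i , eq = mult-positive (u ∘ suc) pos in suc i , eq

  -- Greedy matching: find a position of `u` with the first value of `v`, delete it by `punchIn`,
  -- and recurse; on both sides the multiplicity of that value drops by one.
  submultiset⇒embedding : ∀ {k n} (v : Tuple k) (u : Tuple n) → (∀ b → mult v b ≤ mult u b) →
    Σ (Fin k → Fin n) λ σ → Injective _≡_ _≡_ σ × (∀ i → u (σ i) ≈ v i)
  submultiset⇒embedding {zero}  v u v⊆u = (λ ()) , (λ { {()} }) , λ ()
  submultiset⇒embedding {suc k} {zero} v u v⊆u =
    contradiction (ℕ.≤-trans (ℕ.≤-reflexive (sym (mult-yes v ≈-refl))) (v⊆u (v zero))) λ ()
  submultiset⇒embedding {suc k} {suc n} v u v⊆u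
    with mult-positive u (ℕ.≤-trans (s≤s z≤n) (ℕ.≤-trans (ℕ.≤-reflexive (sym (mult-yes v ≈-refl))) (v⊆u (v zero))))
  ... | i , ui≈v₀ with submultiset⇒embedding (v ∘ suc) (u ∘ punchIn i) rest
    where
    rest : ∀ b → mult (v ∘ suc) b ≤ mult (u ∘ punchIn i) b
    rest b with v zero ≟ b | v⊆u b
    ... | yes v₀≈b | le = ℕ.s≤s⁻¹ (ℕ.≤-trans le (ℕ.≤-reflexive (mult-punchIn-yes u i (≈-trans ui≈v₀ v₀≈b))))
    ... | no  v₀≉b | le = ℕ.≤-trans le (ℕ.≤-reflexive (mult-punchIn-no u i (λ ui≈b → v₀≉b (≈-trans (≈-sym ui≈v₀) ui≈b))))
  ...   | σ , inj , eq = σ' , inj' , eq'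
    where
    σ' : Fin (suc k) → Fin (suc n)
    σ' zero    = i
    σ' (suc j) = punchIn i (σ j)
    inj' : Injective _≡_ _≡_ σ'
    inj' {zero}  {zero}  _ = refl
    inj' {zero}  {suc y} p = contradiction (sym p) (Fin.punchInᵢ≢i i (σ y))
    inj' {suc x} {zero}  p = contradiction p (Fin.punchInᵢ≢i i (σ x))
    inj' {suc x} {suc y} p = cong suc (inj (Fin.punchIn-injective i (σ x) (σ y) p))
    eq' : ∀ j → u (σ' j) ≈ v j
    eq' zero    = ui≈v₀
    eq' (suc j) = eq j

  -- Tuples of nonzero elements avoiding a given sum.

  open ListDifference (Fin._≟_ {q})

  length-allFin-∖ : ∀ ys → q ∸ length ys ≤ length (allFin q ∖ ys)
  length-allFin-∖ ys = ℕ.m≤n+o⇒m∸n≤o q (length ys)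
    (ℕ.≤-trans (ℕ.≤-reflexive (sym (List.length-tabulate (λ i → i)))) (length-∖ ys (Unique.allFin⁺ q)))

  nonzeros : List (Fin q)
  nonzeros = allFin q ∖ (index 0# ∷ [])

  ∈-nonzeros⁻ : ∀ {i} → i ∈ nonzeros → ¬ (elem i ≈ 0#)
  ∈-nonzeros⁻ i∈ i≈0 = proj₂ (∈-∖⁻ {xs = allFin q} (index 0# ∷ []) i∈) (here (index-unique i≈0))

  total : ∀ {n} → Vec (Fin q) n → Carrier
  total v = sumT (lookup (Vec.map elem v))

  -- All tuples of nonzero elements whose sum is not - r.
  admissible : ∀ n → Carrier → List (Vec (Fin q) (suc n))
  admissible zero    r = List.map (_∷ []) (allFin q ∖ (index (- r) ∷ index 0# ∷ []))
  admissible (suc n) r = prefixed (λ x → admissible n (r + elem x)) nonzeros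

  admissible-sound : ∀ n r {v} → v ∈ admissible n r →
                     Allᵛ (λ i → ¬ (elem i ≈ 0#)) v × ¬ (r + total v ≈ 0#)
  admissible-sound zero r v∈ with ∈-map⁻ (_∷ []) v∈
  ... | x , x∈ , refl with ∈-∖⁻ {xs = allFin q} (index (- r) ∷ index 0# ∷ []) x∈
  ...   | _ , x∉ =
    (λ x≈0 → x∉ (there (here (index-unique x≈0)))) ∷ [] ,
    λ sum≈0 → x∉ (here (index-unique (+-inverseʳ-unique r (elem x)
      (≈-trans (+-congˡ (≈-sym (+-identityʳ (elem x)))) sum≈0))))
  admissible-sound (suc n) r v∈ with ∈-prefixed⁻ (λ x → admissible n (r + elem x)) nonzeros v∈
  ... | x , w , x∈ , w∈ , refl with admissible-sound n (r + elem x) w∈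
  ...   | w≉0 , sum≉0 = ∈-nonzeros⁻ x∈ ∷ w≉0 , λ sum≈0 → sum≉0 (≈-trans (+-assoc r (elem x) (total w)) sum≈0)

  admissible-unique : ∀ n r → Unique (admissible n r)
  admissible-unique zero    r = Unique.map⁺ Vec.∷-injectiveˡ
    (∖-unique (index (- r) ∷ index 0# ∷ []) (Unique.allFin⁺ q))
  admissible-unique (suc n) r = prefixed-unique _ (∖-unique (index 0# ∷ []) (Unique.allFin⁺ q))
    (λ x → admissible-unique n (r + elem x))

  -- Every entry but the last has at least q - 1 choices. The last must avoid zero and one more
  -- element determined by the earlier entries; the two may coincide, so this is only a lower bound.
  length-admissible : ∀ n r → (q ∸ 1) ℕ.^ n ℕ.* (q ∸ 2) ≤ length (admissible n r)
  length-admissible zero    r = ℕ.≤-trans (ℕ.≤-reflexive (ℕ.*-identityˡ (q ∸ 2)))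
    (ℕ.≤-trans (length-allFin-∖ (index (- r) ∷ index 0# ∷ []))
      (ℕ.≤-reflexive (sym (List.length-map (_∷ []) (allFin q ∖ (index (- r) ∷ index 0# ∷ []))))))
  length-admissible (suc n) r = ℕ.≤-trans (ℕ.≤-reflexive (ℕ.*-assoc (q ∸ 1) ((q ∸ 1) ℕ.^ n) (q ∸ 2)))
    (ℕ.≤-trans (ℕ.*-monoˡ-≤ _ (length-allFin-∖ (index 0# ∷ [])))
      (length-prefixed _ nonzeros (λ x → length-admissible n (r + elem x))))

  -- Tuples of values attained in low degree.

  nodes : List (Fin q)
  nodes = allFin q ∖ (index 1# ∷ index 0# ∷ [])

  -- As `0#` and `1#` are distinct, each of the two removals does shorten the list.
  length-nodes : length nodes ≤ q ∸ 2
  length-nodes = ℕ.m+n≤o⇒m≤o∸n (length nodes) (subst (_≤ q) (ℕ.+-comm 2 (length nodes))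
    (ℕ.≤-trans (s≤s (length-∖-∷ (index 0# ∷ []) (∈-allFin (index 1#)) 1∉[0]))
      (ℕ.≤-trans (length-∖-∷ [] (∈-allFin (index 0#)) λ ()) (ℕ.≤-reflexive (List.length-tabulate (λ i → i))))))
    where
    1∉[0] : index 1# ∉ index 0# ∷ []
    1∉[0] (here eq) = 0≉1 (≈-trans (≈-sym (elem-index 0#)) (≈-trans (≈-reflexive (cong elem (sym eq))) (elem-index 1#)))

  complement : ∀ {n} → Vec (Fin q) n → List (Fin q)
  complement s = allFin q ∖ (index 0# ∷ index 1# ∷ toList s)

  -- The values at s of the polynomial that takes the value 1 at 0 and whose roots
  -- are exactly the elements outside {0, 1} ∪ s.
  values : ∀ {n} → Vec (Fin q) n → Vec (Fin q) n
  values s = Vec.map (λ i → index (vanishing (complement s) (elem i) * inv (vanishing (complement s) 0#))) s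

  -- The order matters: the point with value `1#` will be moved to 0, where it fixes the constant
  -- factor, and the point with value `a` will be moved to 1.
  padded : ∀ {n} ℓ → Carrier → Vec (Fin q) n → Tuple (2 ℕ.+ n ℕ.+ ℓ)
  padded ℓ a v = lookup ((1# ∷ a ∷ Vec.map elem v) ++ replicate ℓ 0#)

  low-degree⇒values : ∀ {n ℓ f} (v : Vec (Fin q) n) (a : Carrier) → Degree≤ ℓ f →
    (σ : Fin (2 ℕ.+ n ℕ.+ ℓ) → Fin q) → Injective _≡_ _≡_ σ → (∀ j → ∃ λ i → σ i ≡ j) →
    (∀ i → f (elem (σ i)) ≈ padded ℓ a v i) →
    ∃ λ s → Allᵛ (_∈ nodes) s × values s ≡ v
  low-degree⇒values {n} {ℓ} {f} v a f≤ σ inj surj f-eq = s , Allᵛ.tabulate⁺ S∈nodes , values-s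
    where
    p : Fin (2 ℕ.+ n ℕ.+ ℓ) → Carrier
    p i = elem (σ i)

    p-injective : ∀ {i j} → p i ≈ p j → i ≡ j
    p-injective eq = inj (elem-inj _ _ eq)

    α β γ : Carrier
    -- Intercept and slope of the affine map taking 0 and 1 to the first two points.
    β = p zero
    α = p (suc zero) - β

    α≉0 : ¬ (α ≈ 0#)
    α≉0 α≈0 with p-injective (x-y≈0⇒x≈y _ _ α≈0)
    ... | ()

    γ = proj₁ (inverse α α≉0)

    αγ≈1 : α * γ ≈ 1#
    αγ≈1 = proj₂ (inverse α α≉0)

    affine : Carrier → Carrier
    affine x = β + α * x

    affine-0 : affine 0# ≈ p zero
    affine-0 = ≈-trans (+-congˡ (zeroʳ α)) (+-identityʳ β)

    affine-1 : affine 1# ≈ p (suc zero)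
    affine-1 = ≈-trans (+-congˡ (*-identityʳ α)) (≈-sym (x≈y+[x-y] _ β))

    affine-section : ∀ x → affine (γ * (x - β)) ≈ x
    affine-section x = begin
      β + α * (γ * (x - β))  ≈⟨ +-congˡ (*-assoc α γ _) ⟨
      β + α * γ * (x - β)    ≈⟨ +-congˡ (*-congʳ αγ≈1) ⟩
      β + 1# * (x - β)       ≈⟨ +-congˡ (*-identityˡ _) ⟩
      β + (x - β)            ≈⟨ x≈y+[x-y] x β ⟨
      x                      ∎

    affine-cong : ∀ {x y} → x ≈ y → affine x ≈ affine y
    affine-cong eq = +-congˡ (*-congˡ eq)

    affine-injective : ∀ {x y} → affine x ≈ affine y → x ≈ y
    affine-injective {x} {y} eq = begin
      x            ≈⟨ unscale x ⟨
      γ * (α * x)  ≈⟨ *-congˡ (+-cancelˡ β _ _ eq) ⟩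
      γ * (α * y)  ≈⟨ unscale y ⟩
      y            ∎
      where
      unscale : ∀ z → γ * (α * z) ≈ z
      unscale z = begin
        γ * (α * z)  ≈⟨ solve 3 (λ γ α z → γ :* (α :* z) := α :* γ :* z) ≈-refl γ α z ⟩
        α * γ * z    ≈⟨ *-congʳ αγ≈1 ⟩
        1# * z       ≈⟨ *-identityˡ z ⟩
        z            ∎

    S : Fin n → Fin q
    -- The preimage under `affine` of the point where `f` takes the i-th value of `v`.
    S i = index (γ * (p (suc (suc (i ↑ˡ ℓ))) - β))

    s : Vec (Fin q) n
    s = tabulate S

    affine-S : ∀ i → affine (elem (S i)) ≈ p (suc (suc (i ↑ˡ ℓ)))
    affine-S i = ≈-trans (affine-cong (elem-index _)) (affine-section _)

    affine-index : ∀ {t x} → t ≡ index x → affine (elem t) ≈ affine x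
    affine-index refl = affine-cong (elem-index _)

    S∈nodes : ∀ i → S i ∈ nodes
    S∈nodes i = ∈-∖⁺ (index 1# ∷ index 0# ∷ []) (∈-allFin (S i)) λ
      { (here eq)         → 1≢ (p-injective (≈-trans (≈-sym affine-1) (≈-trans (≈-sym (affine-index eq)) (affine-S i))))
      ; (there (here eq)) → 0≢ (p-injective (≈-trans (≈-sym affine-0) (≈-trans (≈-sym (affine-index eq)) (affine-S i)))) }
      where
      1≢ : ∀ {m} {j : Fin m} → Fin.suc (Fin.zero {m}) ≢ suc (suc j)
      1≢ ()
      0≢ : ∀ {m} {j : Fin m} → Fin.zero {suc m} ≢ suc (suc j)
      0≢ ()

    T : List (Fin q)
    T = complement s

    h : Carrier → Carrier
    h x = f (affine x)

    h≤ : Degree≤ ℓ h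
    h≤ = Degree≤-affine ℓ α β f≤

    f-cong : ∀ {x y} → x ≈ y → f x ≈ f y
    f-cong = Degree≤-cong ℓ f≤

    h-roots : ∀ {t} → t ∈ T → h (elem t) ≈ 0#
    h-roots {t} t∈T with ∈-∖⁻ {xs = allFin q} (index 0# ∷ index 1# ∷ toList s) t∈T | surj (index (affine (elem t)))
    ... | _ , t∉ | j , σj≡ = at j (≈-trans (≈-reflexive (cong elem σj≡)) (elem-index _))
      where
      -- As `t` is outside 0, 1 and `s`, its image is none of the first 2 + n points; so it is one
      -- of the points with value `0#`.
      at : ∀ j → p j ≈ affine (elem t) → h (elem t) ≈ 0#
      at zero eq = contradiction (here (index-unique (affine-injective (≈-trans (≈-sym eq) (≈-sym affine-0))))) t∉
      at (suc zero) eq =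
        contradiction (there (here (index-unique (affine-injective (≈-trans (≈-sym eq) (≈-sym affine-1)))))) t∉
      at (suc (suc j)) eq with splitAt n j | Fin.join-splitAt n ℓ j
      ... | inj₁ i | refl = contradiction
        (there (there (subst (_∈ toList s) (sym t≡Si) (∈-toList⁺ (∈-tabulate⁺ S i))))) t∉
        where
        t≡Si : t ≡ S i
        t≡Si = elem-inj _ _ (affine-injective (≈-trans (≈-sym eq) (≈-sym (affine-S i))))
      ... | inj₂ k | refl = begin
        f (affine (elem t))        ≈⟨ f-cong eq ⟨
        f (p (suc (suc (n ↑ʳ k)))) ≈⟨ f-eq _ ⟩
        padded ℓ a v (suc (suc (n ↑ʳ k))) ≈⟨ ≈-reflexive (Vec.lookup-++ʳ (Vec.map elem v) (replicate ℓ 0#) k) ⟩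
        lookup (replicate ℓ 0#) k  ≈⟨ ≈-reflexive (Vec.lookup-replicate k 0#) ⟩
        0#                         ∎

    ℓ≤T : ℓ ≤ length T
    -- Injectivity of `σ` gives 2 + n + ℓ ≤ q, and at most 2 + n points are removed.
    ℓ≤T = ℕ.≤-trans (ℕ.m+n≤o⇒m≤o∸n ℓ (subst (_≤ q) (ℕ.+-comm (2 ℕ.+ n) ℓ) (Fin.injective⇒≤ inj)))
      (ℕ.≤-trans (ℕ.≤-reflexive (cong (λ m → q ∸ (2 ℕ.+ m)) (sym (Vec.length-toList s))))
        (length-allFin-∖ (index 0# ∷ index 1# ∷ toList s)))

    factored : ∃ λ c → ∀ x → h x ≈ vanishing T x * c
    factored = factorisation T h≤ (∖-unique (index 0# ∷ index 1# ∷ toList s) (Unique.allFin⁺ q)) h-roots ℓ≤T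

    h-0 : h 0# ≈ 1#
    h-0 = ≈-trans (f-cong affine-0) (f-eq zero)

    h-eq : ∀ x → h x ≈ vanishing T x * inv (vanishing T 0#)
    -- The value 1 at 0 determines the constant, so `h` depends on `s` alone.
    h-eq x = ≈-trans (proj₂ factored x)
      (*-congˡ (x*y≈1⇒y≈inv (≈-trans (≈-sym (proj₂ factored 0#)) h-0)))

    value-S : ∀ i → index (vanishing T (elem (S i)) * inv (vanishing T 0#)) ≡ lookup v i
    value-S i = sym (index-unique (begin
      elem (lookup v i)                 ≈⟨ ≈-reflexive (sym (Vec.lookup-map i elem v)) ⟩
      lookup (Vec.map elem v) i         ≈⟨ ≈-reflexive (sym (Vec.lookup-++ˡ (Vec.map elem v) (replicate ℓ 0#) i)) ⟩
      padded ℓ a v (suc (suc (i ↑ˡ ℓ))) ≈⟨ f-eq _ ⟨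
      f (p (suc (suc (i ↑ˡ ℓ))))        ≈⟨ f-cong (affine-S i) ⟨
      h (elem (S i))                    ≈⟨ h-eq _ ⟩
      vanishing T (elem (S i)) * inv (vanishing T 0#) ∎))

    values-s : values s ≡ v
    values-s = trans (sym (Vec.tabulate-∘ _ S)) (trans (Vec.tabulate-cong value-S) (Vec.tabulate∘lookup v))

  -- Here n + 2 is m - 2. After the common factor q - 2, positive by `3 ≤ q`, is split off, the
  -- comparison is (q - 2)^(n + 1) < (q - 1)^(n + 1); the positive exponent reflects m > 3.
  unattained : ∀ n → 3 ≤ q → ∃ λ v → v ∈ admissible (suc n) 1# ×
               (∀ s → Allᵛ (_∈ nodes) s → values s ≢ v)
  unattained n 3≤q with ListDifference.missing (Vec.≡-dec Fin._≟_)
      {ys = List.map values (words nodes (2 ℕ.+ n))} (admissible-unique (suc n) 1#) fewer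
    where
    q-2<q-1 : q ∸ 2 < q ∸ 1
    q-2<q-1 = ℕ.∸-monoʳ-< ℕ.≤-refl (ℕ.≤-trans (ℕ.n≤1+n 2) 3≤q)
    fewer : length (List.map values (words nodes (2 ℕ.+ n))) < length (admissible (suc n) 1#)
    fewer = ℕ.≤-<-trans
      (ℕ.≤-trans (ℕ.≤-reflexive (trans (List.length-map values (words nodes (2 ℕ.+ n))) (length-words nodes (2 ℕ.+ n))))
        (ℕ.≤-trans (ℕ.^-monoˡ-≤ (2 ℕ.+ n) length-nodes) (ℕ.≤-reflexive (ℕ.*-comm (q ∸ 2) _))))
      (ℕ.<-≤-trans (ℕ.*-monoˡ-< (q ∸ 2) {{ℕ.>-nonZero (ℕ.∸-monoˡ-≤ 2 3≤q)}} (ℕ.^-monoˡ-< (suc n) q-2<q-1))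
        (length-admissible (suc n) 1#))
  ... | v , v∈ , v∉ = v , v∈ , λ s s∈ eq → v∉ (subst (_∈ List.map values (words nodes (2 ℕ.+ n))) eq (∈-map⁺ values (∈-words s∈)))

  -- Multiplicities and sums of padded tuples.

  mult-replicate : ∀ n {x b} → x ≈ b → mult (lookup (replicate n x)) b ≡ n
  mult-replicate zero    x≈b = refl
  mult-replicate (suc n) {x} {b} x≈b = trans (mult-yes (lookup (replicate (suc n) x)) x≈b) (cong suc (mult-replicate n x≈b))

  mult-replicate-≉ : ∀ n {x b} → ¬ (x ≈ b) → mult (lookup (replicate n x)) b ≡ 0
  mult-replicate-≉ zero    x≉b = refl
  mult-replicate-≉ (suc n) {x} x≉b = trans (mult-no (lookup (replicate (suc n) x)) x≉b) (mult-replicate-≉ n x≉b)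

  mult-++-≤ : ∀ {m n} (xs : Vec Carrier m) (ys : Vec Carrier n) b →
              mult (lookup (xs ++ ys)) b ≤ m ℕ.+ mult (lookup ys) b
  mult-++-≤ []       ys b = ℕ.≤-refl
  mult-++-≤ (x ∷ xs) ys b with x ≟ b
  ... | yes _ = s≤s (mult-++-≤ xs ys b)
  ... | no  _ = ℕ.m≤n⇒m≤1+n (mult-++-≤ xs ys b)

  mult-++-≉ : ∀ {m n} (xs : Vec Carrier m) (ys : Vec Carrier n) {b} → Allᵛ (λ x → ¬ (x ≈ b)) xs →
              mult (lookup (xs ++ ys)) b ≡ mult (lookup ys) b
  mult-++-≉ []       ys []          = refl
  mult-++-≉ (x ∷ xs) ys (x≉b ∷ xs≉b) = trans (mult-no (lookup (x ∷ xs ++ ys)) x≉b) (mult-++-≉ xs ys xs≉b)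

  sumT-++-replicate : ∀ {m} (xs : Vec Carrier m) n → sumT (lookup (xs ++ replicate n 0#)) ≈ sumT (lookup xs)
  sumT-++-replicate []       zero    = ≈-refl
  sumT-++-replicate []       (suc n) = ≈-trans (+-identityˡ _) (sumT-++-replicate [] n)
  sumT-++-replicate (x ∷ xs) n       = +-congˡ (sumT-++-replicate xs n)

  -- From an unattained tuple to the multiset.

  HighDegreeRange : ℕ → Set (c ⊔ˡ ℓ')
  HighDegreeRange ℓ = Σ (Tuple q) λ M →
    (sumT M ≈ 0#) × (mult M 0# ≡ ℓ) × (∀ b → mult M b ≤ ℓ) ×
    (∀ f → HasRange f M → ∃ λ d → (degree f ≡ just d) × (ℓ < d))

  unattained⇒highDegreeRange : ∀ k ℓ → q ≡ 4 ℕ.+ k ℕ.+ ℓ → 4 ℕ.+ k ≤ ℓ → (v : Vec (Fin q) (2 ℕ.+ k)) →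
    Allᵛ (λ i → ¬ (elem i ≈ 0#)) v → ¬ (1# + total v ≈ 0#) → (∀ s → Allᵛ (_∈ nodes) s → values s ≢ v) →
    HighDegreeRange ℓ
  unattained⇒highDegreeRange k ℓ refl m≤ℓ v v≉0 1+v≉0 v-unattained = M , sum-M , mult-M-0 , mult-M , degree-M
    where
    a : Carrier
    -- Forced by the zero sum; admissibility of `v` makes it nonzero.
    a = - (1# + total v)

    xs : Vec Carrier (4 ℕ.+ k)
    xs = 1# ∷ a ∷ Vec.map elem v

    M : Tuple q
    M = padded ℓ a v

    a≉0 : ¬ (a ≈ 0#)
    a≉0 a≈0 = 1+v≉0 (begin
      1# + total v      ≈⟨ +-identityʳ _ ⟨
      1# + total v + 0# ≈⟨ +-congˡ a≈0 ⟨
      1# + total v + a  ≈⟨ -‿inverseʳ _ ⟩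
      0#                ∎)

    xs≉0 : Allᵛ (λ x → ¬ (x ≈ 0#)) xs
    xs≉0 = (0≉1 ∘ ≈-sym) ∷ a≉0 ∷ Allᵛ.map⁺ v≉0

    sum-M : sumT M ≈ 0#
    sum-M = begin
      sumT M              ≈⟨ sumT-++-replicate xs ℓ ⟩
      1# + (a + total v)  ≈⟨ solve 3 (λ o a t → o :+ (a :+ t) := (o :+ t) :+ a) ≈-refl 1# a (total v) ⟩
      1# + total v + a    ≈⟨ -‿inverseʳ _ ⟩
      0#                  ∎

    mult-M-0 : mult M 0# ≡ ℓ
    mult-M-0 = trans (mult-++-≉ xs (replicate ℓ 0#) xs≉0) (mult-replicate ℓ ≈-refl)

    mult-M : ∀ b → mult M b ≤ ℓ
    mult-M b with 0# ≟ b
    ... | yes 0≈b = ℕ.≤-reflexive (trans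
      (mult-++-≉ xs (replicate ℓ 0#) (Allᵛ.map (λ x≉0 x≈b → x≉0 (≈-trans x≈b (≈-sym 0≈b))) xs≉0))
      (mult-replicate ℓ 0≈b))
    -- A nonzero value occurs only among the first 4 + k entries, and 4 + k ≤ ℓ.
    ... | no 0≉b = ℕ.≤-trans (mult-++-≤ xs (replicate ℓ 0#) b) (ℕ.≤-trans
      (ℕ.≤-reflexive (trans (cong (4 ℕ.+ k ℕ.+_) (mult-replicate-≉ ℓ 0≉b)) (ℕ.+-identityʳ _))) m≤ℓ)

    degree≰ℓ : ∀ f → HasRange f M → ¬ Degree≤ ℓ (eval f)
    degree≰ℓ f f-range f≤ =
      -- Equal multiplicities give an injection of `Fin q` into itself, hence a bijection matching
      -- points with entries of `M`.
      let σ , inj , f∘σ≈M = submultiset⇒embedding M (range f) (λ b → ℕ.≤-reflexive (sym (f-range b)))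
          s , s∈ , values-s = low-degree⇒values v a f≤ σ inj (injective⇒surjective ℕ.≤-refl inj) f∘σ≈M
      in v-unattained s s∈ values-s

    degree-M : ∀ f → HasRange f M → ∃ λ d → (degree f ≡ just d) × (ℓ < d)
    degree-M f f-range with degree f in eq
    -- The zero polynomial is constant, so the same bound excludes it.
    ... | nothing = contradiction
      (Degree≤-const ℓ (λ x y → ≈-trans (degree-nothing f eq x) (≈-sym (degree-nothing f eq y))))
      (degree≰ℓ f f-range)
    ... | just d with ℓ ℕ.<? d
    ...   | yes ℓ<d = d , refl , ℓ<d
    ...   | no  ℓ≮d = contradiction (Degree≤-mono (ℕ.≮⇒≥ ℓ≮d) (degree-just f eq)) (degree≰ℓ f f-range)

  highDegreeRange : ∀ k ℓ → q ≡ 4 ℕ.+ k ℕ.+ ℓ → 4 ℕ.+ k ≤ ℓ → HighDegreeRange ℓ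
  highDegreeRange k ℓ q≡ m≤ℓ =
    let v , v∈ , v-unattained = unattained k (subst (3 ≤_) (sym q≡) (s≤s (s≤s (s≤s z≤n))))
        v≉0 , 1+v≉0 = admissible-sound (suc k) 1# v∈
    in unattained⇒highDegreeRange k ℓ q≡ m≤ℓ v v≉0 1+v≉0 v-unattained

-- Arithmetic of `q` and `ℓ`.

open import Data.Nat using (_*_)

theorem3 : ∀ {c ℓ' : Level} (q : ℕ) (F : FiniteField c ℓ' q) (ℓ : ℕ) →
           q ≤ 2 * ℓ → ℓ < q ∸ 3 →
           let open FiniteField F
               open FieldDefs F
           in Σ (Tuple q) λ M →
                (sumT M ≈ 0#) × (mult M 0# ≡ ℓ) × (∀ b → mult M b ≤ ℓ) ×
                (∀ f → HasRange f M → ∃ λ d → (degree f ≡ just d) × (ℓ < d))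
theorem3 q F ℓ q≤2ℓ ℓ<q-3 = highDegreeRange k ℓ q≡4+k+ℓ 4+k≤ℓ
  where
  open PolynomialRanges F

  k : ℕ
  -- This is m - 4 for m = q - ℓ.
  k = q ∸ 3 ∸ suc ℓ

  3≤q : 3 ≤ q
  -- `ℓ < q ∸ 3` makes the truncated difference nonzero, so nothing was cut off.
  3≤q = ℕ.<⇒≤ (ℕ.m∸n≢0⇒n<m (ℕ.m<n⇒n≢0 ℓ<q-3))

  q≡4+k+ℓ : q ≡ 4 ℕ.+ k ℕ.+ ℓ
  q≡4+k+ℓ = trans (sym (ℕ.m+[n∸m]≡n 3≤q)) (cong (3 ℕ.+_)
    (trans (sym (ℕ.m∸n+n≡m ℓ<q-3)) (ℕ.+-suc k ℓ)))

  4+k≤ℓ : 4 ℕ.+ k ≤ ℓ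
  -- Cancel ℓ in 4 + k + ℓ = q ≤ ℓ + ℓ; `2 * ℓ` unfolds to ℓ + (ℓ + 0).
  4+k≤ℓ = ℕ.+-cancelʳ-≤ ℓ (4 ℕ.+ k) ℓ (subst (_≤ ℓ ℕ.+ ℓ) q≡4+k+ℓ
    (subst (λ m → q ≤ ℓ ℕ.+ m) (ℕ.+-identityʳ ℓ) q≤2ℓ))
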